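{- Let $\alpha$ be an ordinal. An ultraproduct of representable substitution algebras of dimension $\alpha$ is a representable substitution algebra of dimension $\alpha$.
   Context: For a nonempty set $U$, $F_\alpha(U)$ is the set of all functions $U^\alpha\to U$. For $s\in U^\alpha$, $\kappa<\alpha$, $x\in U$, $s\langle\kappa,x\rangle$ agrees with $s$ except that its $\kappa$-th entry is $x$. On $F_\alpha(U)$ set $(f*_\kappa g)(s)=g(s\langle\kappa,f(s)\rangle)$ and $V_\kappa(s)=s_\kappa$. A function substitution algebra of dimension $\alpha$ ($FSA_\alpha$) is $\langle A,*_\kappa,V_\kappa\rangle_{\kappa<\alpha}$ with $A\subseteq F_\alpha(U)$ closed under every $*_\kappa$ and containing every $V_\kappa$. A substitution algebra of dimension $\alpha$ ($SA_\alpha$) is an algebra $\langle A,*_\kappa,v_\kappa\rangle_{\kappa<\alpha}$ satisfying, for all $\kappa,\lambda<\alpha$: (1) $x*_\kappa v_\kappa=x$; (2) $x*_\kappa v_\lambda=v_\lambda$ for $\kappa\neq\lambda$; (3) $v_\kappa*_\kappa x=x$; (4) if $w*_\lambda x=x$ for all $w$, then $x*_\lambda(v_\lambda*_\kappa z)=x*_\lambda(x*_\kappa z)$; (5) $(x*_\kappa y)*_\kappa z=x*_\kappa(y*_\kappa z)$; (6) if $w*_\lambda x=x$ for all $w$, then $x*_\kappa(y*_\lambda z)=(x*_\kappa y)*_\lambda(x*_\kappa z)$ for $\kappa\neq\lambda$. An $SA_\alpha$ is representable if it is isomorphic to an $FSA_\alpha$. -}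

module Defs where

open import Level using (0ℓ)
open import Data.Product using (Σ; _×_; ∃)
open import Data.Sum using (_⊎_)
open import Data.Empty using (⊥)
open import Data.Unit using (⊤)
open import Relation.Nullary using (¬_; yes; no)
open import Relation.Binary using (Rel; IsEquivalence; IsStrictTotalOrder; Setoid)
open import Relation.Binary.PropositionalEquality using (_≡_)
open import Induction.WellFounded using (WellFounded)

-- Ordinals: a (small) strict well-order, i.e. a well-ordered type.
-- Only the underlying set (with its decidable equality) is used by the
-- definitions of substitution algebras.

record Ordinal : Set₁ where
  field
    Idx   : Set
    _<_   : Rel Idx 0ℓ
    isSTO : IsStrictTotalOrder _≡_ _<_
    wf    : WellFounded _<_
  open IsStrictTotalOrder isSTO public using (_≟_)

record SAStr (α : Ordinal) : Set₁ where
  open Ordinal α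
  field
    Carrier : Set
    _≈_     : Rel Carrier 0ℓ
    _*⟨_⟩_  : Carrier → Idx → Carrier → Carrier
    v       : Idx → Carrier

record IsSA {α : Ordinal} (A : SAStr α) : Set where
  open Ordinal α
  open SAStr A
  field
    isEquivalence : IsEquivalence _≈_
    *-cong : ∀ κ {x x' y y'} → x ≈ x' → y ≈ y' → (x *⟨ κ ⟩ y) ≈ (x' *⟨ κ ⟩ y')
    ax1 : ∀ κ x → (x *⟨ κ ⟩ v κ) ≈ x
    ax2 : ∀ κ λ' x → ¬ (κ ≡ λ') → (x *⟨ κ ⟩ v λ') ≈ v λ'
    ax3 : ∀ κ x → (v κ *⟨ κ ⟩ x) ≈ x
    ax4 : ∀ κ λ' x z → (∀ w → (w *⟨ λ' ⟩ x) ≈ x) →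
          (x *⟨ λ' ⟩ (v λ' *⟨ κ ⟩ z)) ≈ (x *⟨ λ' ⟩ (x *⟨ κ ⟩ z))
    ax5 : ∀ κ x y z → ((x *⟨ κ ⟩ y) *⟨ κ ⟩ z) ≈ (x *⟨ κ ⟩ (y *⟨ κ ⟩ z))
    ax6 : ∀ κ λ' x y z → ¬ (κ ≡ λ') → (∀ w → (w *⟨ λ' ⟩ x) ≈ x) →
          (x *⟨ κ ⟩ (y *⟨ λ' ⟩ z)) ≈ ((x *⟨ κ ⟩ y) *⟨ λ' ⟩ (x *⟨ κ ⟩ z))

-- Function substitution algebras.  The base set U is a setoid; U^α is
-- Idx → U with pointwise equality; F_α(U) consists of the functions
-- U^α → U respecting equality, with pointwise equality.

module _ (α : Ordinal) (U : Setoid 0ℓ 0ℓ) where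
  open Ordinal α
  open Setoid U renaming (Carrier to ∣U∣; _≈_ to _≈U_)

  Seq : Set
  Seq = Idx → ∣U∣

  _≈S_ : Seq → Seq → Set
  s ≈S t = ∀ μ → s μ ≈U t μ

  upd : Seq → Idx → ∣U∣ → Seq
  upd s κ x μ with μ ≟ κ
  ... | yes _ = x
  ... | no  _ = s μ

  RawF : Set
  RawF = Seq → ∣U∣

  RespectsEq : RawF → Set
  RespectsEq f = ∀ {s t} → s ≈S t → f s ≈U f t

  _≈F_ : RawF → RawF → Set
  f ≈F g = ∀ s → f s ≈U g s

  _*F⟨_⟩_ : RawF → Idx → RawF → RawF
  (f *F⟨ κ ⟩ g) s = g (upd s κ (f s))

  VF : Idx → RawF
  VF κ s = s κ

record FSA (α : Ordinal) : Set₁ where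
  open Ordinal α
  field
    U       : Setoid 0ℓ 0ℓ
    point   : Setoid.Carrier U
    Mem     : RawF α U → Set
    mem-ok  : ∀ {f} → Mem f → RespectsEq α U f
    mem-*   : ∀ κ {f g} → Mem f → Mem g → Mem (_*F⟨_⟩_ α U f κ g)
    mem-V   : ∀ κ → Mem (VF α U κ)

record IsoToFSA {α : Ordinal} (A : SAStr α) (F : FSA α) : Set₁ where
  open Ordinal α
  open SAStr A
  open FSA F
  field
    h       : Carrier → RawF α U
    h-mem   : ∀ x → Mem (h x)
    h-cong  : ∀ {x y} → x ≈ y → _≈F_ α U (h x) (h y)
    h-inj   : ∀ {x y} → _≈F_ α U (h x) (h y) → x ≈ y
    h-surj  : ∀ f → Mem f → ∃ λ x → _≈F_ α U (h x) f
    h-*     : ∀ κ x y → _≈F_ α U (h (x *⟨ κ ⟩ y)) (_*F⟨_⟩_ α U (h x) κ (h y))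
    h-v     : ∀ κ → _≈F_ α U (h (v κ)) (VF α U κ)

Representable : {α : Ordinal} → SAStr α → Set₁
Representable {α} A = Σ (FSA α) λ F → IsoToFSA A F

record Ultrafilter (J : Set) : Set₁ where
  field
    InD      : (J → Set) → Set
    full     : InD (λ _ → ⊤)
    proper   : ¬ InD (λ _ → ⊥)
    up       : ∀ {X Y} → (∀ j → X j → Y j) → InD X → InD Y
    inter    : ∀ {X Y} → InD X → InD Y → InD (λ j → X j × Y j)
    ultra    : ∀ X → InD X ⊎ InD (λ j → ¬ X j)

Ultraproduct : {α : Ordinal} {J : Set} → Ultrafilter J → (J → SAStr α) → SAStr α
Ultraproduct {α} {J} D A = record
  { Carrier = (j : J) → SAStr.Carrier (A j)
  ; _≈_     = λ x y → Ultrafilter.InD D (λ j → SAStr._≈_ (A j) (x j) (y j))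
  ; _*⟨_⟩_  = λ x κ y j → SAStr._*⟨_⟩_ (A j) (x j) κ (y j)
  ; v       = λ κ j → SAStr.v (A j) κ
  }

{-# OPTIONS --safe #-}
module Submission where

-- The axioms transfer to the ultraproduct P because their infinitary hypothesis
-- "w * x = x for all w" follows from one instance of it.
-- For the representation, sequences of D-classes have no simultaneous choice of
-- representatives when α is infinite, so P cannot simply act on the ultraproduct
-- of the base sets.  Instead the base set is freely generated: infinitary terms
-- op x s (the value of x at the sequence s of terms) over generators gen κ,
-- modulo the inductively generated least suitable equality, whose congruence
-- rule has infinitely many premises.  It remains to see that op x gen = op y gen
-- forces x = y.  A derivation has only finitely many middle terms at its top level,
-- so families of terms can be adjoined one at a time, and adjoining a family n to a
-- closed set of families proves no new equalities between old terms: if the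
-- derivation identifies n with an old sequence, replace n by that sequence, and
-- otherwise replace n by the generators outside a large finite set of coordinates.
-- Hence op x gen = op y gen already has a derivation without families, in which
-- every sequence is a finite modification of the generators; this one holds in the
-- product of the algebras of functions modulo D, needing only finite intersections.

open import Defs
open import Level using (0ℓ)
open import Data.Product using (Σ-syntax; ∃; _×_; _,_; proj₁; proj₂)
open import Data.Sum using (_⊎_; inj₁; inj₂)
open import Data.Empty using (⊥; ⊥-elim)
open import Data.Unit using (⊤; tt)
open import Data.Unit.Polymorphic using () renaming (⊤ to ⊤ₚ)
open import Data.List using (List; []; _∷_; _++_)
open import Data.List.Membership.Propositional using (_∈_; _∉_)
open import Data.List.Membership.Propositional.Properties using (∈-++⁺ˡ; ∈-++⁺ʳ)
open import Data.List.Relation.Unary.Any using (here; there)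
open import Data.List.Relation.Binary.Subset.Propositional using (_⊆_)
open import Data.List.Relation.Binary.Subset.Propositional.Properties using (⊆-refl; ⊆-trans; xs⊆xs++ys; xs⊆ys++xs)
open import Data.List.Membership.DecPropositional using (_∈?_)
open import Function using (_∘_; id)
open import Relation.Nullary using (¬_; yes; no)
open import Relation.Binary using (Rel; IsEquivalence; Reflexive; Setoid)
open import Relation.Binary.PropositionalEquality as ≡ using (_≡_)

-- Transfer of the substitution algebra axioms to the ultraproduct.

module ReducedProduct {α : Ordinal} {J : Set} (D : Ultrafilter J) (A : J → SAStr α)
                      (sa : ∀ j → IsSA (A j)) where
  open Ordinal α
  open Ultrafilter D
  private
    module A j = SAStr (A j)
    module E j = IsEquivalence (IsSA.isEquivalence (sa j))
    module S j = IsSA (sa j)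

  all : ∀ {X : J → Set} → (∀ j → X j) → InD X
  all f = up (λ j _ → f j) full

  -- v κ already tests independence of the coordinate λ' ≠ κ, so the hypothesis
  -- on all w follows from a single instance and no choice is needed to transfer it.
  independent : ∀ j κ λ' x → ¬ (κ ≡ λ') → A._≈_ j (A._*⟨_⟩_ j (A.v j κ) λ' x) x →
                ∀ w → A._≈_ j (A._*⟨_⟩_ j w λ' x) x
  independent j κ λ' x κ≢λ' e w =
    E.trans j (S.*-cong j λ' (E.refl j) (E.sym j e))
   (E.trans j (E.sym j (S.ax5 j λ' w (A.v j κ) x))
   (E.trans j (S.*-cong j λ' (S.ax2 j λ' κ w (κ≢λ' ∘ ≡.sym)) (E.refl j)) e))

  isSA : IsSA (Ultraproduct D A)
  isSA = record
    { isEquivalence = record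
        { refl  = all λ j → E.refl j
        ; sym   = up λ j → E.sym j
        ; trans = λ p q → up (λ { j (a , b) → E.trans j a b }) (inter p q) }
    ; *-cong = λ κ p q → up (λ { j (a , b) → S.*-cong j κ a b }) (inter p q)
    ; ax1 = λ κ x → all λ j → S.ax1 j κ (x j)
    ; ax2 = λ κ λ' x κ≢λ' → all λ j → S.ax2 j κ λ' (x j) κ≢λ'
    ; ax3 = λ κ x → all λ j → S.ax3 j κ (x j)
    ; ax4 = ax4
    ; ax5 = λ κ x y z → all λ j → S.ax5 j κ (x j) (y j) (z j)
    ; ax6 = λ κ λ' x y z κ≢λ' h → up
        (λ j e → S.ax6 j κ λ' (x j) (y j) (z j) κ≢λ' (independent j κ λ' (x j) κ≢λ' e))
        (h λ j → A.v j κ)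
    }
    where
    open SAStr (Ultraproduct D A)
    ax4 : ∀ κ λ' x z → (∀ w → (w *⟨ λ' ⟩ x) ≈ x) →
          (x *⟨ λ' ⟩ (v λ' *⟨ κ ⟩ z)) ≈ (x *⟨ λ' ⟩ (x *⟨ κ ⟩ z))
    ax4 κ λ' x z h with κ ≟ λ'
    ... | no κ≢λ' = up (λ j e → S.ax4 j κ λ' (x j) (z j) (independent j κ λ' (x j) κ≢λ' e))
                       (h λ j → A.v j κ)
    -- With equal coordinates the instance `w = x` of the hypothesis is idempotence of `x`, which
    -- with `ax3` and `ax5` gives the claim.
    ... | yes ≡.refl = up (λ j e → E.trans j (S.*-cong j κ (E.refl j) (S.ax3 j κ (z j)))
                             (E.trans j (S.*-cong j κ (E.sym j e) (E.refl j))
                                        (S.ax5 j κ (x j) (x j) (z j))))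
                          (h x)

-- Infinitary terms and derivable equality.

module Terms {α : Ordinal} (A : SAStr α) (A-refl : Reflexive (SAStr._≈_ A)) where
  open Ordinal α
  open SAStr A renaming (_≈_ to _≈A_)

  -- gens is the sequence of generators, fam an arbitrary sequence.  Keeping finite
  -- modifications s [ κ ↦ t ] as syntax makes a term mention finitely many families.
  mutual
    data Term : Set where
      gen : Idx → Term
      pt  : Term
      op  : Carrier → Sub → Term

    data Sub : Set where
      gens   : Sub
      fam    : (Idx → Term) → Sub
      _[_↦_] : Sub → Idx → Term → Sub

  Family : Set
  Family = Idx → Term

  lookup : Sub → Idx → Term
  lookup gens          μ = gen μ
  lookup (fam σ)       μ = σ μ
  lookup (s [ κ ↦ t ]) μ with μ ≟ κ
  ... | yes _ = t
  ... | no  _ = lookup s μ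

  mutual
    Inᵗ : ∀ {ℓ} → (Family → Set ℓ) → Term → Set ℓ
    Inᵗ S (gen κ)  = ⊤ₚ
    Inᵗ S pt       = ⊤ₚ
    Inᵗ S (op x s) = Inˢ S s

    Inˢ : ∀ {ℓ} → (Family → Set ℓ) → Sub → Set ℓ
    Inˢ S gens          = ⊤ₚ
    Inˢ S (fam σ)       = S σ
    Inˢ S (s [ κ ↦ t ]) = Inˢ S s × Inᵗ S t

  module _ {ℓ ℓ'} {S : Family → Set ℓ} {S' : Family → Set ℓ'} (sub : ∀ {σ} → S σ → S' σ) where
    mutual
      monoᵗ : ∀ u → Inᵗ S u → Inᵗ S' u
      monoᵗ (gen κ)  _ = _
      monoᵗ pt       _ = _
      monoᵗ (op x s) e = monoˢ s e

      monoˢ : ∀ s → Inˢ S s → Inˢ S' s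
      monoˢ gens          _       = _
      monoˢ (fam σ)       e       = sub e
      monoˢ (s [ κ ↦ t ]) (e , f) = monoˢ s e , monoᵗ t f

  Closed : (Family → Set) → Set
  Closed S = ∀ {σ} → S σ → ∀ μ → Inᵗ S (σ μ)

  lookup-In : ∀ {S} → Closed S → ∀ s → Inˢ S s → ∀ μ → Inᵗ S (lookup s μ)
  lookup-In cl gens          e       μ = _
  lookup-In cl (fam σ)       e       μ = cl e μ
  lookup-In cl (s [ κ ↦ t ]) (e , f) μ with μ ≟ κ
  ... | yes _ = f
  ... | no  _ = lookup-In cl s e μ

  -- S restricts only the middle terms of transitivity: a derivation whose end terms
  -- are in S, for a closed S, then stays in S.
  infix 4 _⊢_≈_

  data _⊢_≈_ (S : Family → Set) : Term → Term → Set where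
    refl   : ∀ {u} → S ⊢ u ≈ u
    sym    : ∀ {u u'} → S ⊢ u ≈ u' → S ⊢ u' ≈ u
    trans  : ∀ {u u' u''} → Inᵗ S u' → S ⊢ u ≈ u' → S ⊢ u' ≈ u'' → S ⊢ u ≈ u''
    cong   : ∀ {x x' s s'} → x ≈A x' → (∀ μ → S ⊢ lookup s μ ≈ lookup s' μ) →
             S ⊢ op x s ≈ op x' s'
    v-op   : ∀ κ s → S ⊢ op (v κ) s ≈ lookup s κ
    *-op   : ∀ κ x y s → S ⊢ op (x *⟨ κ ⟩ y) s ≈ op y (s [ κ ↦ op x s ])

  reflexive : ∀ {S u u'} → u ≡ u' → S ⊢ u ≈ u'
  reflexive ≡.refl = refl

  upd-cong : ∀ {S s s' t t'} κ → (∀ μ → S ⊢ lookup s μ ≈ lookup s' μ) → S ⊢ t ≈ t' →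
             ∀ μ → S ⊢ lookup (s [ κ ↦ t ]) μ ≈ lookup (s' [ κ ↦ t' ]) μ
  upd-cong κ p q μ with μ ≟ κ
  ... | yes _ = q
  ... | no  _ = p μ

  _[_↦*_] : Sub → List Idx → Family → Sub
  s [ []    ↦* n ] = s
  s [ κ ∷ F ↦* n ] = (s [ F ↦* n ]) [ κ ↦ n κ ]

  lookup-∈ : ∀ s F n {μ} → μ ∈ F → lookup (s [ F ↦* n ]) μ ≡ n μ
  lookup-∈ s (κ ∷ F) n {μ} p with μ ≟ κ
  lookup-∈ s (κ ∷ F) n p         | yes ≡.refl = ≡.refl
  lookup-∈ s (κ ∷ F) n (here q)  | no μ≢κ     = ⊥-elim (μ≢κ q)
  lookup-∈ s (κ ∷ F) n (there p) | no _       = lookup-∈ s F n p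

  lookup-∉ : ∀ s F n {μ} → μ ∉ F → lookup (s [ F ↦* n ]) μ ≡ lookup s μ
  lookup-∉ s []      n     p = ≡.refl
  lookup-∉ s (κ ∷ F) n {μ} p with μ ≟ κ
  ... | yes q = ⊥-elim (p (here q))
  ... | no  _ = lookup-∉ s F n (p ∘ there)

  Cons : (Family → Set) → (Family → Set) → Set
  Cons S S' = ∀ {u u'} → Inᵗ S u → Inᵗ S u' → S' ⊢ u ≈ u' → S ⊢ u ≈ u'

  -- Conservativity of adjoining a single family.

  module AddFamily (S : Family → Set) (cl : Closed S) (n : Family) (n-In : ∀ μ → Inᵗ S (n μ)) where

    S⁺ : Family → Set
    S⁺ σ = S σ ⊎ σ ≡ n

    old : ∀ u → Inᵗ S u → Inᵗ S⁺ u
    old = monoᵗ inj₁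

    cl⁺ : Closed S⁺
    cl⁺ {σ} (inj₁ e)      μ = old (σ μ) (cl e μ)
    cl⁺     (inj₂ ≡.refl) μ = old (n μ) (n-In μ)

    updAll-In : ∀ s F → Inˢ S s → Inˢ S (s [ F ↦* n ])
    updAll-In s []      e = e
    updAll-In s (κ ∷ F) e = updAll-In s F e , n-In κ

    dom : Sub → List Idx
    dom gens          = []
    dom (fam _)       = []
    dom (s [ κ ↦ _ ]) = κ ∷ dom s

    -- The translation depends on the evidence, which may declare an occurrence of n
    -- old even though it is propositionally equal to n.
    module Translate (ρ : Sub) (ρ-In : Inˢ S ρ) where
      mutual
        trᵗ : ∀ u → Inᵗ S⁺ u → Term
        trᵗ (gen κ)  _ = gen κ
        trᵗ pt       _ = pt
        trᵗ (op x s) e = op x (trˢ s e)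

        trˢ : ∀ s → Inˢ S⁺ s → Sub
        trˢ gens          _        = gens
        trˢ (fam σ)       (inj₁ _) = fam σ
        trˢ (fam σ)       (inj₂ _) = ρ
        trˢ (s [ κ ↦ t ]) (e , f)  = trˢ s e [ κ ↦ trᵗ t f ]

      mutual
        trᵗ-In : ∀ u e → Inᵗ S (trᵗ u e)
        trᵗ-In (gen κ)  _ = _
        trᵗ-In pt       _ = _
        trᵗ-In (op x s) e = trˢ-In s e

        trˢ-In : ∀ s e → Inˢ S (trˢ s e)
        trˢ-In gens          _        = _
        trˢ-In (fam σ)       (inj₁ e) = e
        trˢ-In (fam σ)       (inj₂ _) = ρ-In
        trˢ-In (s [ κ ↦ t ]) (e , f)  = trˢ-In s e , trᵗ-In t f

      mutual
        trᵗ-old : ∀ u e → trᵗ u (old u e) ≡ u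
        trᵗ-old (gen κ)  _ = ≡.refl
        trᵗ-old pt       _ = ≡.refl
        trᵗ-old (op x s) e = ≡.cong (op x) (trˢ-old s e)

        trˢ-old : ∀ s e → trˢ s (monoˢ inj₁ s e) ≡ s
        trˢ-old gens          _       = ≡.refl
        trˢ-old (fam σ)       _       = ≡.refl
        trˢ-old (s [ κ ↦ t ]) (e , f) = ≡.cong₂ (_[ κ ↦_]) (trˢ-old s e) (trᵗ-old t f)

      -- Agreement of `ρ` with `n` is asked only at `μ`, so this serves both a linked `ρ` and a
      -- truncation, which is known to agree with `n` only on a finite set.
      tr-lookup : ∀ s e μ → S ⊢ lookup ρ μ ≈ n μ →
                  S ⊢ lookup (trˢ s e) μ ≈ trᵗ (lookup s μ) (lookup-In cl⁺ s e μ)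
      tr-lookup gens          e             μ p = refl
      tr-lookup (fam σ)       (inj₁ e)      μ p = reflexive (≡.sym (trᵗ-old (σ μ) (cl e μ)))
      tr-lookup (fam σ)       (inj₂ ≡.refl) μ p =
        ≡.subst (S ⊢ lookup ρ μ ≈_) (≡.sym (trᵗ-old (σ μ) (n-In μ))) p
      tr-lookup (s [ κ ↦ t ]) (e , f)       μ p with μ ≟ κ
      ... | yes _ = refl
      ... | no  _ = tr-lookup s e μ p

    -- An old substitution that can replace `n` throughout a derivation.
    Link : Set
    Link = Σ[ ρ ∈ Sub ] Inˢ S ρ × (∀ μ → S ⊢ lookup ρ μ ≈ n μ)

    module Linked (ρ : Sub) (ρ-In : Inˢ S ρ) (agree : ∀ μ → S ⊢ lookup ρ μ ≈ n μ) where
      open Translate ρ ρ-In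

      mutual
        irrᵗ : ∀ u e e' → S ⊢ trᵗ u e ≈ trᵗ u e'
        irrᵗ (gen κ)  _ _  = refl
        irrᵗ pt       _ _  = refl
        irrᵗ (op x s) e e' = cong A-refl (irrˢ s e e')

        irrˢ : ∀ s e e' μ → S ⊢ lookup (trˢ s e) μ ≈ lookup (trˢ s e') μ
        irrˢ gens          _             _             μ = refl
        irrˢ (fam σ)       (inj₁ _)      (inj₁ _)      μ = refl
        irrˢ (fam σ)       (inj₁ _)      (inj₂ ≡.refl) μ = sym (agree μ)
        irrˢ (fam σ)       (inj₂ ≡.refl) (inj₁ _)      μ = agree μ
        irrˢ (fam σ)       (inj₂ _)      (inj₂ _)      μ = refl
        irrˢ (s [ κ ↦ t ]) (e , f)       (e' , f')     μ = upd-cong κ (irrˢ s e e') (irrᵗ t f f') μ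

      sound : ∀ {u u'} → S⁺ ⊢ u ≈ u' → ∀ e e' → S ⊢ trᵗ u e ≈ trᵗ u' e'
      sound {u} refl e e' = irrᵗ u e e'
      sound (sym d) e e' = sym (sound d e' e)
      sound (trans {u' = u} i d d') e e' = trans (trᵗ-In u i) (sound d e i) (sound d' i e')
      sound (cong {s = s} {s'} p q) e e' = cong p λ μ →
        let i = lookup-In cl⁺ s e μ; i' = lookup-In cl⁺ s' e' μ in
        trans (trᵗ-In (lookup s μ) i) (tr-lookup s e μ (agree μ))
          (trans (trᵗ-In (lookup s' μ) i') (sound (q μ) i i') (sym (tr-lookup s' e' μ (agree μ))))
      sound (v-op κ s) e e' =
        let i = lookup-In cl⁺ s e κ in
        trans (lookup-In cl (trˢ s e) (trˢ-In s e) κ) (v-op κ (trˢ s e))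
          (trans (trᵗ-In (lookup s κ) i) (tr-lookup s e κ (agree κ)) (irrᵗ (lookup s κ) i e'))
      sound (*-op κ x y s) e e' =
        trans (trˢ-In s e , trˢ-In s e) (*-op κ x y (trˢ s e))
              (irrᵗ (op y (s [ κ ↦ op x s ])) (e , e) e')

      conservative : Cons S S⁺
      conservative {u} {u'} e e' d =
        ≡.subst₂ (S ⊢_≈_) (trᵗ-old u e) (trᵗ-old u' e') (sound d (old u e) (old u' e'))

    -- Truth for all large enough finite sets. Only finitely many thresholds can be joined, so
    -- `cong` needs an argument of its own.
    Ev : (List Idx → Set) → Set
    Ev P = Σ[ F₀ ∈ List Idx ] (∀ F → F₀ ⊆ F → P F)

    always : ∀ {P : List Idx → Set} → (∀ F → P F) → Ev P
    always p = [] , λ F _ → p F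

    map₂ : ∀ {P Q R : List Idx → Set} → (∀ F → P F → Q F → R F) →
           Link ⊎ Ev P → Link ⊎ Ev Q → Link ⊎ Ev R
    map₂ f (inj₁ l)       _              = inj₁ l
    map₂ f (inj₂ _)       (inj₁ l)       = inj₁ l
    map₂ f (inj₂ (G , p)) (inj₂ (H , q)) = inj₂ (G ++ H , λ F i →
      f F (p F (⊆-trans (xs⊆xs++ys G H) i)) (q F (⊆-trans (xs⊆ys++xs H G) i)))

    map₁ : ∀ {P Q : List Idx → Set} → (∀ F → P F → Q F) → Link ⊎ Ev P → Link ⊎ Ev Q
    map₁ f p = map₂ (λ F a _ → f F a) p (inj₂ (always {λ _ → ⊤} λ _ → tt))

    eventually-⊇ : ∀ G → Link ⊎ Ev (G ⊆_)
    eventually-⊇ G = inj₂ (G , λ F i → i)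

    eventually-all : ∀ {P : Idx → List Idx → Set} G → (∀ μ → Link ⊎ Ev (P μ)) →
                     Link ⊎ Ev (λ F → ∀ μ → μ ∈ G → P μ F)
    eventually-all []      p = inj₂ (always λ F μ ())
    eventually-all (κ ∷ G) p =
      map₂ (λ { F a b μ (here ≡.refl) → a ; F a b μ (there i) → b μ i }) (p κ) (eventually-all G p)

    -- Truncation replaces `n` by its values on `F` and by generators elsewhere, which mentions only
    -- families of `S`.
    module _ (F : List Idx) where
      open Translate (gens [ F ↦* n ]) (updAll-In gens F _) public
        using () renaming (trᵗ to truncᵗ; trˢ to truncˢ; trᵗ-In to truncᵗ-In; trˢ-In to truncˢ-In;
                           trᵗ-old to truncᵗ-old; tr-lookup to trunc-lookup′)

    trunc-lookup : ∀ F s e {μ} → μ ∈ F →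
                   S ⊢ lookup (truncˢ F s e) μ ≈ truncᵗ F (lookup s μ) (lookup-In cl⁺ s e μ)
    trunc-lookup F s e {μ} i = trunc-lookup′ F s e μ (reflexive (lookup-∈ gens F n i))

    mutual
      irrᵗ : ∀ u e e' → Link ⊎ Ev (λ F → S ⊢ truncᵗ F u e ≈ truncᵗ F u e')
      irrᵗ (gen κ)  _ _  = inj₂ (always λ F → refl)
      irrᵗ pt       _ _  = inj₂ (always λ F → refl)
      irrᵗ (op x s) e e' = map₁ (λ F → cong A-refl) (irrˢ s e e')

      irrˢ : ∀ s e e' → Link ⊎ Ev (λ F → ∀ μ → S ⊢ lookup (truncˢ F s e) μ ≈ lookup (truncˢ F s e') μ)
      irrˢ gens          _             _             = inj₂ (always λ F μ → refl)
      irrˢ (fam σ)       (inj₁ _)      (inj₁ _)      = inj₂ (always λ F μ → refl)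
      -- Evidence that `n` is already in `S` makes `n` a link to itself.
      irrˢ (fam σ)       (inj₁ e)      (inj₂ ≡.refl) = inj₁ (fam n , e , λ μ → refl)
      irrˢ (fam σ)       (inj₂ ≡.refl) (inj₁ e)      = inj₁ (fam n , e , λ μ → refl)
      irrˢ (fam σ)       (inj₂ _)      (inj₂ _)      = inj₂ (always λ F μ → refl)
      irrˢ (s [ κ ↦ t ]) (e , f)       (e' , f')     =
        map₂ (λ F p q → upd-cong κ p q) (irrˢ s e e') (irrᵗ t f f')

    -- Outside dom s, a substitution agrees with its root.
    data Root (s : Sub) (e : Inˢ S⁺ s) : Set where
      oldRoot : ∀ r → Inˢ S r →
                (∀ {μ} → μ ∉ dom s → lookup s μ ≡ lookup r μ) →
                (∀ F {μ} → μ ∉ dom s → lookup (truncˢ F s e) μ ≡ lookup r μ) → Root s e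
      newRoot : (∀ {μ} → μ ∉ dom s → lookup s μ ≡ n μ) →
                (∀ F {μ} → μ ∉ dom s → lookup (truncˢ F s e) μ ≡ lookup (gens [ F ↦* n ]) μ) → Root s e

    lookup-skip : ∀ s κ t {G r μ} → μ ∉ κ ∷ G → (μ ∉ G → lookup s μ ≡ r) → lookup (s [ κ ↦ t ]) μ ≡ r
    lookup-skip s κ t {μ = μ} i p with μ ≟ κ
    ... | yes j = ⊥-elim (i (here j))
    ... | no  _ = p (i ∘ there)

    root : ∀ s e → Root s e
    root gens          e             = oldRoot gens _ (λ _ → ≡.refl) (λ F _ → ≡.refl)
    root (fam σ)       (inj₁ e)      = oldRoot (fam σ) e (λ _ → ≡.refl) (λ F _ → ≡.refl)
    root (fam σ)       (inj₂ ≡.refl) = newRoot (λ _ → ≡.refl) (λ F _ → ≡.refl)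
    root (s [ κ ↦ t ]) (e , f) with root s e
    ... | oldRoot r i p q = oldRoot r i (λ j → lookup-skip s κ t j p)
                              (λ F j → lookup-skip (truncˢ F s e) κ (truncᵗ F t f) j (q F))
    ... | newRoot p q     = newRoot (λ j → lookup-skip s κ t j p)
                              (λ F j → lookup-skip (truncˢ F s e) κ (truncᵗ F t f) j (q F))

    -- The Link alternative cannot be decided across the infinitely many premises of
    -- cong; but a premise between old terms yields an equality over S in both cases.
    Goal : Term → Term → Set
    Goal u u' = ∀ e e' → Link ⊎ Ev (λ F → S ⊢ truncᵗ F u e ≈ truncᵗ F u' e')

    descend : ∀ {u u'} → S⁺ ⊢ u ≈ u' → Goal u u' → Inᵗ S u → Inᵗ S u' → S ⊢ u ≈ u'
    descend {u} {u'} d k e e' with k (old u e) (old u' e')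
    ... | inj₁ (ρ , i , a) = Linked.conservative ρ i a e e' d
    ... | inj₂ (F , p)     = ≡.subst₂ (S ⊢_≈_) (truncᵗ-old F u e) (truncᵗ-old F u' e') (p F ⊆-refl)

    -- Only the finitely many coordinates in `G` need a common threshold. Off `G` each side is its
    -- root: two old roots are equal over `S` by `descend`, two new ones have the same truncation,
    -- and mixed roots yield a link.
    cong-goal : ∀ {x x'} s s' → x ≈A x' → (∀ μ → S⁺ ⊢ lookup s μ ≈ lookup s' μ) →
                (∀ μ → Goal (lookup s μ) (lookup s' μ)) → Goal (op x s) (op x' s')
    cong-goal {x} {x'} s s' x≈x' d k e e' = main (root s e) (root s' e')
      where
      G = dom s ++ dom s'

      ∉ˡ : ∀ {μ} → μ ∉ G → μ ∉ dom s
      ∉ˡ i = i ∘ ∈-++⁺ˡ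

      ∉ʳ : ∀ {μ} → μ ∉ G → μ ∉ dom s'
      ∉ʳ i = i ∘ ∈-++⁺ʳ (dom s)

      inside : Link ⊎ Ev (λ F → ∀ μ → μ ∈ G → S ⊢ lookup (truncˢ F s e) μ ≈ lookup (truncˢ F s' e') μ)
      inside = map₂ (λ F G⊆F p μ i →
                 let f = lookup-In cl⁺ s e μ; f' = lookup-In cl⁺ s' e' μ in
                 trans (truncᵗ-In F (lookup s μ) f) (trunc-lookup F s e (G⊆F i))
                   (trans (truncᵗ-In F (lookup s' μ) f') (p μ i) (sym (trunc-lookup F s' e' (G⊆F i)))))
               (eventually-⊇ G)
               (eventually-all G λ μ → k μ (lookup-In cl⁺ s e μ) (lookup-In cl⁺ s' e' μ))

      combine : (∀ F {μ} → μ ∉ G → S ⊢ lookup (truncˢ F s e) μ ≈ lookup (truncˢ F s' e') μ) →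
                Link ⊎ Ev (λ F → S ⊢ truncᵗ F (op x s) e ≈ truncᵗ F (op x' s') e')
      combine outside = map₁ (λ F p → cong x≈x' (pointwise F p)) inside
        where
        pointwise : ∀ F → (∀ μ → μ ∈ G → S ⊢ lookup (truncˢ F s e) μ ≈ lookup (truncˢ F s' e') μ) →
                    ∀ μ → S ⊢ lookup (truncˢ F s e) μ ≈ lookup (truncˢ F s' e') μ
        pointwise F p μ with _∈?_ _≟_ μ G
        ... | yes i = p μ i
        ... | no  i = outside F i

      below : ∀ {μ w w'} → lookup s μ ≡ w → lookup s' μ ≡ w' → Inᵗ S w → Inᵗ S w' → S ⊢ w ≈ w'
      below {μ} ≡.refl ≡.refl = descend (d μ) (k μ)

      link : ∀ r → Inˢ S r → (∀ {μ} → μ ∉ G → S ⊢ lookup r μ ≈ n μ) → Link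
      link r r-In p = r [ G ↦* n ] , updAll-In r G r-In , agree
        where
        agree : ∀ μ → S ⊢ lookup (r [ G ↦* n ]) μ ≈ n μ
        agree μ with _∈?_ _≟_ μ G
        ... | yes i = reflexive (lookup-∈ r G n i)
        ... | no  i = ≡.subst (S ⊢_≈ n μ) (≡.sym (lookup-∉ r G n i)) (p i)

      main : Root s e → Root s' e' →
             Link ⊎ Ev (λ F → S ⊢ truncᵗ F (op x s) e ≈ truncᵗ F (op x' s') e')
      main (oldRoot r i p q) (oldRoot r' i' p' q') = combine λ F {μ} j →
        ≡.subst₂ (S ⊢_≈_) (≡.sym (q F (∉ˡ j))) (≡.sym (q' F (∉ʳ j)))
          (below (p (∉ˡ j)) (p' (∉ʳ j)) (lookup-In cl r i μ) (lookup-In cl r' i' μ))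
      main (newRoot p q) (newRoot p' q') = combine λ F j →
        reflexive (≡.trans (q F (∉ˡ j)) (≡.sym (q' F (∉ʳ j))))
      -- The old root equals `n` off `G`; overwriting it on `G` with the values of `n` gives
      -- agreement everywhere.
      main (oldRoot r i p q) (newRoot p' q') = inj₁ (link r i λ {μ} j →
        below (p (∉ˡ j)) (p' (∉ʳ j)) (lookup-In cl r i μ) (n-In μ))
      main (newRoot p q) (oldRoot r' i' p' q') = inj₁ (link r' i' λ {μ} j →
        sym (below (p (∉ˡ j)) (p' (∉ʳ j)) (n-In μ) (lookup-In cl r' i' μ)))

    goal : ∀ {u u'} → S⁺ ⊢ u ≈ u' → Goal u u'
    goal {u} refl e e' = irrᵗ u e e'
    goal (sym d) e e' = map₁ (λ F → sym) (goal d e' e)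
    goal (trans {u' = u} i d d') e e' =
      map₂ (λ F → trans (truncᵗ-In F u i)) (goal d e i) (goal d' i e')
    goal (cong {s = s} {s'} p d) e e' = cong-goal s s' p d (λ μ → goal (d μ)) e e'
    goal (v-op κ s) e e' =
      let i = lookup-In cl⁺ s e κ in
      map₂ (λ F κ∈F p → trans (lookup-In cl (truncˢ F s e) (truncˢ-In F s e) κ) (v-op κ (truncˢ F s e))
             (trans (truncᵗ-In F (lookup s κ) i) (trunc-lookup F s e (κ∈F (here ≡.refl))) p))
        (eventually-⊇ (κ ∷ [])) (irrᵗ (lookup s κ) i e')
    goal (*-op κ x y s) e e' =
      map₁ (λ F → trans (truncˢ-In F s e , truncˢ-In F s e) (*-op κ x y (truncˢ F s e)))
           (irrᵗ (op y (s [ κ ↦ op x s ])) (e , e) e')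

    conservative : Cons S S⁺
    conservative e e' d = descend d (goal d) e e'

  -- Adjoining all families and restricting derivations.

  _⊆ᶠ_ : (Family → Set) → (Family → Set) → Set
  S ⊆ᶠ S' = ∀ {σ} → S σ → S' σ

  Extension : (Family → Set) → ((Family → Set) → Set) → Set₁
  Extension Q P = Σ[ Q' ∈ (Family → Set) ] Closed Q' × Q ⊆ᶠ Q' × Cons Q Q' × P Q'

  Adjoinable : Family → Set₁
  Adjoinable σ = ∀ Q → Closed Q → Extension Q (λ Q' → Q' σ)

  mutual
    -- A term mentions finitely many families directly, so they are adjoined in succession and
    -- conservativity composes.
    adjoinᵗ : ∀ {Q₀ : Family → Set} u → Inᵗ (λ σ → Q₀ σ ⊎ Adjoinable σ) u →
              ∀ Q → Closed Q → Q₀ ⊆ᶠ Q → Extension Q (λ Q' → Inᵗ Q' u)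
    adjoinᵗ (gen κ)  _ Q cl i = Q , cl , id , (λ _ _ d → d) , _
    adjoinᵗ pt       _ Q cl i = Q , cl , id , (λ _ _ d → d) , _
    adjoinᵗ (op x s) e Q cl i = adjoinˢ s e Q cl i

    adjoinˢ : ∀ {Q₀ : Family → Set} s → Inˢ (λ σ → Q₀ σ ⊎ Adjoinable σ) s →
              ∀ Q → Closed Q → Q₀ ⊆ᶠ Q → Extension Q (λ Q' → Inˢ Q' s)
    adjoinˢ gens    _        Q cl i = Q , cl , id , (λ _ _ d → d) , _
    adjoinˢ (fam σ) (inj₁ e) Q cl i = Q , cl , id , (λ _ _ d → d) , i e
    adjoinˢ (fam σ) (inj₂ a) Q cl i = a Q cl
    adjoinˢ (s [ κ ↦ t ]) (e , f) Q cl i =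
      let Q₁ , cl₁ , i₁ , c₁ , e₁ = adjoinˢ s e Q cl i
          Q₂ , cl₂ , i₂ , c₂ , f₂ = adjoinᵗ t f Q₁ cl₁ (λ q → i₁ (i q))
      in Q₂ , cl₂ , (λ q → i₂ (i₁ q))
         , (λ {u} {u'} j j' d → c₁ j j' (c₂ (monoᵗ i₁ u j) (monoᵗ i₁ u' j') d))
         , (monoˢ i₂ s e₁ , f₂)

  -- Q varies in the induction: each middle term is first adjoined to Q.
  restrict : ∀ {Q₀ S} → (∀ {σ} → S σ → Q₀ σ ⊎ Adjoinable σ) → ∀ {u u'} → S ⊢ u ≈ u' →
             ∀ Q → Closed Q → Q₀ ⊆ᶠ Q → Inᵗ Q u → Inᵗ Q u' → Q ⊢ u ≈ u'
  restrict a refl    Q cl i e e' = refl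
  restrict a (sym d) Q cl i e e' = sym (restrict a d Q cl i e' e)
  restrict a (trans {u} {u'} {u''} m d d') Q cl i e e' =
    let Q₁ , cl₁ , i₁ , c₁ , m₁ = adjoinᵗ u' (monoᵗ a u' m) Q cl i
    in c₁ e e' (trans m₁ (restrict a d  Q₁ cl₁ (λ q → i₁ (i q)) (monoᵗ i₁ u e) m₁)
                         (restrict a d' Q₁ cl₁ (λ q → i₁ (i q)) m₁ (monoᵗ i₁ u'' e')))
  -- The ends of each premise lie in the closed `Q`, so every premise restricts to `Q` separately
  -- and infinitely many extensions never have to be combined.
  restrict a (cong {s = s} {s'} p d) Q cl i e e' =
    cong p λ μ → restrict a (d μ) Q cl i (lookup-In cl s e μ) (lookup-In cl s' e' μ)
  restrict a (v-op κ s)     Q cl i e e' = v-op κ s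
  restrict a (*-op κ x y s) Q cl i e e' = *-op κ x y s

  -- The families occurring hereditarily in a term.
  mutual
    Herᵗ : Term → Family → Set
    Herᵗ (gen κ)  τ = ⊥
    Herᵗ pt       τ = ⊥
    Herᵗ (op x s) τ = Herˢ s τ

    Herˢ : Sub → Family → Set
    Herˢ gens          τ = ⊥
    Herˢ (fam σ)       τ = τ ≡ σ ⊎ ∃ λ κ → Herᵗ (σ κ) τ
    Herˢ (s [ κ ↦ t ]) τ = Herˢ s τ ⊎ Herᵗ t τ

  mutual
    Herᵗ-self : ∀ u → Inᵗ (Herᵗ u) u
    Herᵗ-self (gen κ)  = _
    Herᵗ-self pt       = _
    Herᵗ-self (op x s) = Herˢ-self s

    Herˢ-self : ∀ s → Inˢ (Herˢ s) s
    Herˢ-self gens          = _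
    Herˢ-self (fam σ)       = inj₁ ≡.refl
    Herˢ-self (s [ κ ↦ t ]) = monoˢ inj₁ s (Herˢ-self s) , monoᵗ inj₂ t (Herᵗ-self t)

  mutual
    Herᵗ-closed : ∀ u → Closed (Herᵗ u)
    Herᵗ-closed (op x s) = Herˢ-closed s

    Herˢ-closed : ∀ s → Closed (Herˢ s)
    Herˢ-closed (fam σ)           (inj₁ ≡.refl)  μ = monoᵗ (λ h → inj₂ (μ , h)) (σ μ) (Herᵗ-self (σ μ))
    Herˢ-closed (fam σ)       {τ} (inj₂ (κ , h)) μ = monoᵗ (λ h → inj₂ (κ , h)) (τ μ) (Herᵗ-closed (σ κ) h μ)
    Herˢ-closed (s [ κ ↦ t ]) {τ} (inj₁ h)       μ = monoᵗ inj₁ (τ μ) (Herˢ-closed s h μ)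
    Herˢ-closed (s [ κ ↦ t ]) {τ} (inj₂ h)       μ = monoᵗ inj₂ (τ μ) (Herᵗ-closed t h μ)

  -- `AddFamily` requires the values of `σ` to lie in a closed set, so all families below `σ` are
  -- put in first. There may be infinitely many; `restrict` removes them again, each being
  -- adjoinable or already in `Q`.
  adjoin-family : ∀ σ → (∀ κ {τ} → Herᵗ (σ κ) τ → Adjoinable τ) → Adjoinable σ
  adjoin-family σ ih Q cl = S⁺ , cl⁺ , (λ q → inj₁ (inj₁ q)) , c , inj₂ ≡.refl
    where
    S : Family → Set
    S τ = Q τ ⊎ ∃ λ κ → Herᵗ (σ κ) τ

    S-closed : Closed S
    S-closed {τ} (inj₁ q)       μ = monoᵗ inj₁ (τ μ) (cl q μ)
    S-closed {τ} (inj₂ (κ , h)) μ = monoᵗ (λ h → inj₂ (κ , h)) (τ μ) (Herᵗ-closed (σ κ) h μ)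

    available : ∀ {τ} → S τ → Q τ ⊎ Adjoinable τ
    available (inj₁ q)       = inj₁ q
    available (inj₂ (κ , h)) = inj₂ (ih κ h)

    open AddFamily S S-closed σ (λ μ → monoᵗ (λ h → inj₂ (μ , h)) (σ μ) (Herᵗ-self (σ μ)))

    c : Cons Q S⁺
    c {u} {u'} e e' d =
      restrict available (conservative (monoᵗ inj₁ u e) (monoᵗ inj₁ u' e') d) Q cl id e e'

  mutual
    Herᵗ-adjoinable : ∀ u {τ} → Herᵗ u τ → Adjoinable τ
    Herᵗ-adjoinable (op x s) h = Herˢ-adjoinable s h

    Herˢ-adjoinable : ∀ s {τ} → Herˢ s τ → Adjoinable τ
    Herˢ-adjoinable (fam σ) (inj₁ ≡.refl)  = adjoin-family σ λ κ → Herᵗ-adjoinable (σ κ)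
    Herˢ-adjoinable (fam σ) (inj₂ (κ , h)) = Herᵗ-adjoinable (σ κ) h
    Herˢ-adjoinable (s [ κ ↦ t ]) (inj₁ h) = Herˢ-adjoinable s h
    Herˢ-adjoinable (s [ κ ↦ t ]) (inj₂ h) = Herᵗ-adjoinable t h

  -- The function algebra on terms modulo derivable equality.

  infix 4 _~_

  _~_ : Rel Term 0ℓ
  _~_ = (λ _ → ⊤) ⊢_≈_

  ~-trans : ∀ {u u' u''} → u ~ u' → u' ~ u'' → u ~ u''
  ~-trans {u' = u'} = trans (total u')
    where
    mutual
      total : ∀ u → Inᵗ (λ _ → ⊤) u
      total (gen κ)  = _
      total pt       = _
      total (op x s) = totalˢ s

      totalˢ : ∀ s → Inˢ (λ _ → ⊤) s
      totalˢ gens          = _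
      totalˢ (fam σ)       = tt
      totalˢ (s [ κ ↦ t ]) = totalˢ s , total t

  ∅ : Family → Set
  ∅ _ = ⊥

  ~-finitary : ∀ {u u'} → Inᵗ ∅ u → Inᵗ ∅ u' → u ~ u' → ∅ ⊢ u ≈ u'
  ~-finitary e e' d =
    restrict {∅} (λ {σ} _ → inj₂ (Herˢ-adjoinable (fam σ) (inj₁ ≡.refl))) d ∅ (λ ()) id e e'

  setoid : Setoid 0ℓ 0ℓ
  setoid = record { Carrier = Term ; _≈_ = _~_
                  ; isEquivalence = record { refl = refl ; sym = sym ; trans = ~-trans } }

  apply : Carrier → RawF α setoid
  apply x s = op x (fam s)

  apply-* : ∀ κ x y → _≈F_ α setoid (apply (x *⟨ κ ⟩ y)) (_*F⟨_⟩_ α setoid (apply x) κ (apply y))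
  apply-* κ x y s = ~-trans (*-op κ x y (fam s)) (cong A-refl pointwise)
    where
    pointwise : ∀ μ → lookup (fam s [ κ ↦ apply x s ]) μ ~ upd α setoid s κ (apply x s) μ
    pointwise μ with μ ≟ κ
    ... | yes _ = refl
    ... | no  _ = refl

  upd-~ : ∀ {s κ t t'} → t ~ t' → ∀ μ → upd α setoid s κ t μ ~ upd α setoid s κ t' μ
  upd-~ {κ = κ} p μ with μ ≟ κ
  ... | yes _ = p
  ... | no  _ = refl

  image : FSA α
  image = record
    { U      = setoid
    -- The constant `pt` gives a point even if there are neither coordinates nor elements.
    ; point  = pt
    ; Mem    = λ f → ∃ λ x → _≈F_ α setoid (apply x) f
    ; mem-ok = λ { (x , p) {s} {t} e → ~-trans (sym (p s)) (~-trans (cong A-refl e) (p t)) }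
    ; mem-*  = λ { κ {f} {g} (x , p) (y , q) → (x *⟨ κ ⟩ y) , λ s →
                 ~-trans (apply-* κ x y s)
                   (~-trans (cong A-refl (upd-~ (p s))) (q (upd α setoid s κ (f s)))) }
    ; mem-V  = λ κ → v κ , λ s → v-op κ (fam s)
    }

  faithful⇒representable : (∀ {x y} → ∅ ⊢ op x gens ≈ op y gens → x ≈A y) → Representable A
  faithful⇒representable inj = image , record
    { h      = apply
    ; h-mem  = λ x → x , λ s → refl
    ; h-cong = λ p s → cong p λ μ → refl
    -- Both functions are compared at the sequence `gen`; `cong` trades `fam gen` for `gens`,
    -- leaving terms without families for `~-finitary`.
    ; h-inj  = λ p → inj (~-finitary _ _
                 (~-trans (cong A-refl λ μ → refl) (~-trans (p gen) (cong A-refl λ μ → refl))))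
    ; h-surj = λ f m → m
    ; h-*    = apply-*
    ; h-v    = λ κ s → v-op κ (fam s)
    }

-- Soundness of family-free derivations modulo the ultrafilter.

module Evaluate {α : Ordinal} {J : Set} (D : Ultrafilter J) (A : J → SAStr α)
                (sa : ∀ j → IsSA (A j)) (rep : ∀ j → Representable (A j)) where
  open Ordinal α
  open Ultrafilter D
  open ReducedProduct D A sa using (all; isSA)
  P : SAStr α
  P = Ultraproduct D A
  open Terms P (IsEquivalence.refl (IsSA.isEquivalence isSA))

  private
    module F j = FSA (proj₁ (rep j))
    module R j = IsoToFSA (proj₂ (rep j))
    module U j = Setoid (F.U j)

  mutual
    ⟦_⟧ : Term → ∀ j → RawF α (F.U j)
    ⟦ gen κ ⟧  j a = a κ
    ⟦ pt ⟧     j a = F.point j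
    ⟦ op x s ⟧ j a = R.h j (x j) (⟦ s ⟧ˢ j a)

    -- Only terms without families are evaluated soundly; fam is sent to an arbitrary value.
    ⟦_⟧ˢ : Sub → ∀ j → Seq α (F.U j) → Seq α (F.U j)
    ⟦ gens ⟧ˢ        j a   = a
    ⟦ fam σ ⟧ˢ       j a   = a
    ⟦ s [ κ ↦ t ] ⟧ˢ j a   = upd α (F.U j) (⟦ s ⟧ˢ j a) κ (⟦ t ⟧ j a)

  ⟦lookup⟧ : ∀ s → Inˢ ∅ s → ∀ μ j a → U._≈_ j (⟦ s ⟧ˢ j a μ) (⟦ lookup s μ ⟧ j a)
  ⟦lookup⟧ gens          e       μ j a = U.refl j
  ⟦lookup⟧ (s [ κ ↦ t ]) (e , f) μ j a with μ ≟ κ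
  ... | yes _ = U.refl j
  ... | no  _ = ⟦lookup⟧ s e μ j a

  _≋_at_ : Term → Term → J → Set
  u ≋ u' at j = _≈F_ α (F.U j) (⟦ u ⟧ j) (⟦ u' ⟧ j)

  support : Sub → List Idx
  support gens          = []
  support (fam σ)       = []
  support (s [ κ ↦ t ]) = κ ∷ support s

  lookup-outside : ∀ s → Inˢ ∅ s → ∀ {μ} → μ ∉ support s → lookup s μ ≡ gen μ
  lookup-outside gens          e           i = ≡.refl
  lookup-outside (s [ κ ↦ t ]) (e , f) {μ} i with μ ≟ κ
  ... | yes j = ⊥-elim (i (here j))
  ... | no  _ = lookup-outside s e (i ∘ there)

  InD-all : ∀ {X : Idx → J → Set} G → (∀ μ → InD (X μ)) → InD (λ j → ∀ μ → μ ∈ G → X μ j)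
  InD-all []      p = all λ j μ ()
  InD-all (κ ∷ G) p = up (λ { j (a , b) μ (here ≡.refl) → a ; j (a , b) μ (there i) → b μ i })
                         (inter (p κ) (InD-all G p))

  -- Without families both sides of `cong` are generators off their finite supports, so finitely
  -- many premises suffice and their index sets intersect in `D`.
  sound : ∀ {u u'} → ∅ ⊢ u ≈ u' → Inᵗ ∅ u → Inᵗ ∅ u' → InD (u ≋ u' at_)
  sound refl    e e' = all λ j a → U.refl j
  sound (sym d) e e' = up (λ j p a → U.sym j (p a)) (sound d e' e)
  sound (trans i d d') e e' =
    up (λ { j (p , q) a → U.trans j (p a) (q a) }) (inter (sound d e i) (sound d' i e'))
  sound (cong {x} {x'} {s} {s'} p d) e e' =
    up (λ { j (x≈x' , q) a → U.trans j (R.h-cong j x≈x' (⟦ s ⟧ˢ j a))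
              (F.mem-ok j (R.h-mem j (x' j)) λ μ →
                U.trans j (⟦lookup⟧ s e μ j a)
                  (U.trans j (pointwise j q μ a) (U.sym j (⟦lookup⟧ s' e' μ j a)))) })
       (inter p (InD-all (support s ++ support s')
          λ μ → sound (d μ) (lookup-In (λ ()) s e μ) (lookup-In (λ ()) s' e' μ)))
    where
    pointwise : ∀ j → (∀ μ → μ ∈ support s ++ support s' → lookup s μ ≋ lookup s' μ at j) →
                ∀ μ → lookup s μ ≋ lookup s' μ at j
    pointwise j q μ a with _∈?_ _≟_ μ (support s ++ support s')
    ... | yes i = q μ i a
    ... | no  i rewrite lookup-outside s e (i ∘ ∈-++⁺ˡ)
                      | lookup-outside s' e' (i ∘ ∈-++⁺ʳ (support s)) = U.refl j
  sound (v-op κ s) e e' =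
    all λ j a → U.trans j (R.h-v j κ (⟦ s ⟧ˢ j a)) (⟦lookup⟧ s e κ j a)
  sound (*-op κ x y s) e e' = all λ j a → R.h-* j κ (x j) (y j) (⟦ s ⟧ˢ j a)

  representable : Representable P
  -- `op x gens` evaluates at `j` to the function representing `x j`, so `h-inj` applies at each `j`
  -- in a set of `D`.
  representable = faithful⇒representable λ d → up (λ j → R.h-inj j) (sound d _ _)

theorem3p6 : (α : Ordinal) (J : Set) (D : Ultrafilter J) (A : J → SAStr α) →
    (∀ j → IsSA (A j)) → (∀ j → Representable (A j)) →
    IsSA (Ultraproduct D A) × Representable (Ultraproduct D A)
theorem3p6 α J D A sa rep = ReducedProduct.isSA D A sa , Evaluate.representable D A sa rep
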